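{- Let $a\ge 3$ and $b\ge 1$ be integers. The equation $x^{2}-(a^{2}b^{2}-2b)y^{2}=-4$ has no solutions in positive integers $x,y$. -}

module Defs where

{-# OPTIONS --safe #-}
-- Put D = a²b² - 2b and A = a²b - 1, so that A² - D a² = 1.  Multiplying a
-- solution x + y√D of norm -4 by the unit A - a√D gives another one, whose
-- second coordinate A y - a x lies strictly between 0 and y as soon as y ≥ 2.
-- Descent therefore ends at y = 1, where x² = D - 4 lies strictly between two
-- consecutive squares.
module Submission where

open import Data.Empty using (⊥)
open import Data.Integer
  using (ℤ; +_; -[1+_]; -_; _+_; _-_; _*_; _^_; _≤_; _<_; _≥_; _>_; +≤+; +<+; ∣_∣; nonNegative)
open import Data.Integer.Properties
open import Data.Integer.Tactic.RingSolver using (solve-∀)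
open import Data.Nat as ℕ using (suc; z≤n; s≤s)
open import Data.Nat.Induction using (<-wellFounded)
open import Data.Product using (_×_; _,_; ∃-syntax)
open import Data.Sum using (_⊎_; inj₁; inj₂)
open import Induction.WellFounded using (Acc; acc)
open import Relation.Binary.Definitions using (tri<; tri≈; tri>)
open import Relation.Nullary using (¬_; contradiction)
open import Relation.Binary.PropositionalEquality
  using (_≡_; refl; sym; trans; cong; cong₂; subst; subst₂; module ≡-Reasoning)
open import Defs

*-nonNeg : ∀ {i j} → + 0 ≤ i → + 0 ≤ j → + 0 ≤ i * j
*-nonNeg {i} {j} 0≤i 0≤j =
  subst (_≤ i * j) (*-zeroʳ i) (*-monoˡ-≤-nonNeg i {{nonNegative 0≤i}} 0≤j)

square-mono-≤ : ∀ {i j} → + 0 ≤ i → i ≤ j → i * i ≤ j * j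
square-mono-≤ {i} {j} 0≤i i≤j = ≤-trans
  (*-monoˡ-≤-nonNeg i {{nonNegative 0≤i}} i≤j)
  (*-monoʳ-≤-nonNeg j {{nonNegative (≤-trans 0≤i i≤j)}} i≤j)

square-cancel-< : ∀ {i j} → + 0 ≤ j → i * i < j * j → i < j
square-cancel-< 0≤j i²<j² = ≰⇒> λ j≤i → <⇒≱ i²<j² (square-mono-≤ 0≤j j≤i)

+∣i∣²≡i² : ∀ i → + ∣ i ∣ * + ∣ i ∣ ≡ i * i
+∣i∣²≡i² (+ _)    = refl
+∣i∣²≡i² -[1+ _ ] = refl

0≤i² : ∀ i → + 0 ≤ i * i
0≤i² i = subst (+ 0 ≤_) (+∣i∣²≡i² i) (*-nonNeg {+ ∣ i ∣} {+ ∣ i ∣} (+≤+ z≤n) (+≤+ z≤n))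

i+k≡j⇒i<j : ∀ {i j k} → + 0 < k → i + k ≡ j → i < j
i+k≡j⇒i<j {i} 0<k eq = subst₂ _<_ (+-identityʳ i) eq (+-monoʳ-< i 0<k)

0<j-i⇒i<j : ∀ {i j} → + 0 < j - i → i < j
0<j-i⇒i<j {i} {j} 0<j-i = i+k≡j⇒i<j 0<j-i (lemma i j)
  where
  lemma : ∀ i j → i + (j - i) ≡ j
  lemma = solve-∀

i<j⇒0<j-i : ∀ {i j} → i < j → + 0 < j - i
i<j⇒0<j-i {i} {j} i<j = subst (_< j - i) (+-inverseʳ i) (+-monoˡ-< (- i) i<j)

no-square-between-consecutive : ∀ {x n} → + 0 ≤ x → + 0 ≤ n →
  n * n < x * x → x * x < (+ 1 + n) * (+ 1 + n) → ⊥
no-square-between-consecutive {x} {n} 0≤x 0≤n n²<x² x²<[1+n]² =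
  <⇒≱ x<1+n (i<j⇒suc[i]≤j n<x)
  where
  n<x : n < x
  n<x = square-cancel-< 0≤x n²<x²
  x<1+n : x < + 1 + n
  x<1+n = square-cancel-< (i≤j⇒i≤1+j 0≤n) x²<[1+n]²

-- The norm equation `x² - D y² = -4` with the constant moved across and products in place of
-- powers, a form the ring solver can handle.
NegFourSolution : (D x y : ℤ) → Set
NegFourSolution D x y = x * x + + 4 ≡ D * (y * y)

module _ (D A a : ℤ) (unit : A * A ≡ + 1 + D * (a * a)) where

  -- Brahmagupta's identity for the product with `A - a√D`: the error in the new equation is the old
  -- error plus the error in `unit` times `x * x - D * (y * y)`, and both errors vanish.
  unit-action : ∀ {x y} → NegFourSolution D x y →
    NegFourSolution D (A * x - a * D * y) (A * y - a * x)
  unit-action {x} {y} sol = i-j≡0⇒i≡j _ _ (trans (brahmagupta A a D x y)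
    (cong₂ (λ u v → u + v * (x * x - D * (y * y)))
      (i≡j⇒i-j≡0 sol) (i≡j⇒i-j≡0 unit)))
    where
    brahmagupta : ∀ A a D x y →
      (A * x - a * D * y) * (A * x - a * D * y) + + 4 - D * ((A * y - a * x) * (A * y - a * x)) ≡
      (x * x + + 4 - D * (y * y)) + (A * A - (+ 1 + D * (a * a))) * (x * x - D * (y * y))
    brahmagupta = solve-∀

  -- Substitute `unit` for `A * A`, then `sol` for `D * (y * y)`. Both bounds on `A * y - a * x`
  -- come from this comparison of squares: the positive surplus gives `a * x < A * y`, and its exact
  -- size gives the upper bound.
  unit-squares : ∀ {x y} → NegFourSolution D x y →
    (A * y) * (A * y) ≡ (a * x) * (a * x) + (y * y + + 4 * (a * a))
  unit-squares {x} {y} sol = begin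
    (A * y) * (A * y)                                 ≡⟨ regroup A y ⟩
    (A * A) * (y * y)                                 ≡⟨ cong (_* (y * y)) unit ⟩
    (+ 1 + D * (a * a)) * (y * y)                     ≡⟨ expand D a y ⟩
    (D * (y * y)) * (a * a) + y * y                   ≡⟨ cong (λ z → z * (a * a) + y * y) sol ⟨
    (x * x + + 4) * (a * a) + y * y                   ≡⟨ collect a x y ⟩
    (a * x) * (a * x) + (y * y + + 4 * (a * a))       ∎
    where
    open ≡-Reasoning
    regroup : ∀ A y → (A * y) * (A * y) ≡ (A * A) * (y * y)
    regroup = solve-∀
    expand : ∀ D a y → (+ 1 + D * (a * a)) * (y * y) ≡ (D * (y * y)) * (a * a) + y * y
    expand = solve-∀
    collect : ∀ a x y → (x * x + + 4) * (a * a) + y * y ≡ (a * x) * (a * x) + (y * y + + 4 * (a * a))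
    collect = solve-∀

  descended-pos : ∀ {x y} → + 0 ≤ A → + 0 < y → NegFourSolution D x y →
    + 0 < A * y - a * x
  descended-pos {x} {+ suc n} 0≤A (+<+ _) sol = i<j⇒0<j-i (square-cancel-<
    (*-nonNeg 0≤A (+≤+ z≤n))
    (i+k≡j⇒i<j (+-mono-<-≤ (+<+ (s≤s z≤n)) (*-nonNeg {+ 4} (+≤+ z≤n) (0≤i² a)))
      (sym (unit-squares {x} sol))))

  -- The claim amounts to `(A - 1) y < a x`. By `unit-squares`, the squares of these two sides
  -- differ by exactly the quantity assumed positive.
  descended-smaller : ∀ {x y} → + 0 ≤ a → + 0 ≤ x →
    + 0 < + 2 * (A - + 1) * (y * y) - + 4 * (a * a) →
    NegFourSolution D x y → A * y - a * x < y
  descended-smaller {x} {y} 0≤a 0≤x 0<gap sol =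
    0<j-i⇒i<j (subst (+ 0 <_) (rearrange A a x y) (i<j⇒0<j-i [A-1]y<ax))
    where
    rearrange : ∀ A a x y → a * x - (A - + 1) * y ≡ y - (A * y - a * x)
    rearrange = solve-∀
    split : ∀ A a y → ((A - + 1) * y) * ((A - + 1) * y) + (+ 2 * (A - + 1) * (y * y) - + 4 * (a * a)) ≡
      (A * y) * (A * y) - (y * y + + 4 * (a * a))
    split = solve-∀
    cancel : ∀ i j → i + j - j ≡ i
    cancel = solve-∀
    [A-1]y<ax : (A - + 1) * y < a * x
    [A-1]y<ax = square-cancel-< (*-nonNeg 0≤a 0≤x) (i+k≡j⇒i<j 0<gap
      (trans (split A a y) (trans (cong (_- (y * y + + 4 * (a * a))) (unit-squares sol)) (cancel _ _))))

disc : ℤ → ℤ → ℤ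
disc a b = a ^ 2 * b ^ 2 - + 2 * b

disc-unit : ∀ a b →
  (a * a * b - + 1) * (a * a * b - + 1) ≡ + 1 + disc a b * (a * a)
disc-unit = identity
  where
  -- solve-∀ does not parse integer powers, so a ^ 2 is unfolded to a * (a * + 1).
  identity : ∀ a b → (a * a * b - + 1) * (a * a * b - + 1) ≡
    + 1 + (a * (a * + 1) * (b * (b * + 1)) - + 2 * b) * (a * a)
  identity = solve-∀

module _ {a b : ℤ} (a≥3 : a ≥ + 3) (b≥1 : b ≥ + 1) where

  0≤a : + 0 ≤ a
  0≤a = ≤-trans (+≤+ z≤n) a≥3

  0≤b : + 0 ≤ b
  0≤b = ≤-trans (+≤+ z≤n) b≥1

  0≤a²-9 : + 0 ≤ a * a - + 9
  0≤a²-9 = i≤j⇒0≤j-i (square-mono-≤ (+≤+ z≤n) a≥3)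

  0≤a²[b-1] : + 0 ≤ a * a * (b - + 1)
  0≤a²[b-1] = *-nonNeg (0≤i² a) (i≤j⇒0≤j-i b≥1)

  0≤unit : + 0 ≤ a * a * b - + 1
  0≤unit = subst (+ 0 ≤_) (identity a b)
    (+-mono-≤ 0≤a²[b-1] (+-mono-≤ 0≤a²-9 (+≤+ {0} {8} z≤n)))
    where
    identity : ∀ a b → a * a * (b - + 1) + ((a * a - + 9) + + 8) ≡ a * a * b - + 1
    identity = solve-∀

  -- The gap is expanded in the nonnegative quantities `a²(b - 1)`, `a² - 9` and `y² - 4`; the
  -- constant 20 is its value at `a = 3`, `b = 1`, `y = 2`. At `b = y = 1` it would be `-2a² - 4`,
  -- so `y = 1` is treated separately.
  0<gap : ∀ {y} → + 2 ≤ y →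
    + 0 < + 2 * ((a * a * b - + 1) - + 1) * (y * y) - + 4 * (a * a)
  0<gap {y} y≥2 = subst (+ 0 <_) (identity a b y)
    (+-mono-≤-< {+ 0} {_} {+ 0} (*-nonNeg {+ 2} (+≤+ z≤n)
      (+-mono-≤ (*-nonNeg 0≤a²[b-1] (0≤i² y))
        (+-mono-≤ (*-nonNeg 0≤a²-9 (+-mono-≤ 0≤y²-4 (+≤+ {0} {2} z≤n)))
                  (*-nonNeg {+ 7} (+≤+ z≤n) 0≤y²-4))))
      (+<+ {0} {20} (s≤s z≤n)))
    where
    0≤y²-4 : + 0 ≤ y * y - + 4
    0≤y²-4 = i≤j⇒0≤j-i (square-mono-≤ (+≤+ z≤n) y≥2)
    identity : ∀ a b y →
      + 2 * (a * a * (b - + 1) * (y * y) + ((a * a - + 9) * (y * y - + 4 + + 2) + + 7 * (y * y - + 4))) + + 20 ≡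
      + 2 * ((a * a * b - + 1) - + 1) * (y * y) - + 4 * (a * a)
    identity = solve-∀

  -- The excess is `(D - 4) - (ab - 1)²` for `D = disc a b`. It equals -1 at `a = 3`, `b = 1`, which
  -- is therefore split off. Otherwise either `b ≥ 2`, or `b = 1` and `a ≥ 4`.
  0<excess : + 0 < + 2 * (a - + 1) * b - + 5 ⊎ (a ≡ + 3 × b ≡ + 1)
  0<excess with <-cmp (+ 1) b | <-cmp (+ 3) a
  ... | tri> _ _ b<1 | _ = contradiction b≥1 (<⇒≱ b<1)
  ... | _ | tri> _ _ a<3 = contradiction a≥3 (<⇒≱ a<3)
  ... | tri≈ _ 1≡b _ | tri≈ _ 3≡a _ = inj₂ (sym 3≡a , sym 1≡b)
  ... | tri< 1<b _ _ | _ = inj₁ (subst (+ 0 <_) (identity a b)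
    (+-mono-≤-< {+ 0} {_} {+ 0} (+-mono-≤ (*-nonNeg (*-nonNeg {+ 2} (+≤+ z≤n) (i≤j⇒0≤j-i a≥3)) 0≤b)
                          (*-nonNeg {+ 4} (+≤+ z≤n) (i≤j⇒0≤j-i (i<j⇒suc[i]≤j 1<b))))
      (+<+ {0} {3} (s≤s z≤n))))
    where
    identity : ∀ a b → + 2 * (a - + 3) * b + + 4 * (b - + 2) + + 3 ≡ + 2 * (a - + 1) * b - + 5
    identity = solve-∀
  ... | tri≈ _ refl _ | tri< 3<a _ _ = inj₁ (subst (+ 0 <_) (identity a)
    (+-mono-≤-< {+ 0} {_} {+ 0} (*-nonNeg {+ 2} (+≤+ z≤n) (i≤j⇒0≤j-i (i<j⇒suc[i]≤j 3<a)))
      (+<+ {0} {1} (s≤s z≤n))))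
    where
    identity : ∀ a → + 2 * (a - + 4) + + 1 ≡ + 2 * (a - + 1) * + 1 - + 5
    identity = solve-∀

  i≡i+4-4 : ∀ i → i ≡ (i + + 4) - + 4
  i≡i+4-4 = solve-∀

  no-solution-at-1 : ∀ {x} → + 0 ≤ x → ¬ NegFourSolution (disc a b) x (+ 1)
  no-solution-at-1 {x} 0≤x sol with 0<excess
  -- Here `D = 7`, so `x² = 3` lies between 1 and 4, one pair of squares below the general
  -- `(ab - 1)²` and `(ab)²`.
  ... | inj₂ (refl , refl) = no-square-between-consecutive {x} {+ 1} 0≤x (+≤+ z≤n)
    (subst (+ 1 <_) (sym x²≡3) (+<+ (s≤s (s≤s z≤n))))
    (subst (_< + 4) (sym x²≡3) (+<+ (s≤s (s≤s (s≤s (s≤s z≤n))))))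
    where
    x²≡3 : x * x ≡ + 3
    x²≡3 = trans (i≡i+4-4 (x * x)) (cong (_- + 4) sol)
  ... | inj₁ 0<e = no-square-between-consecutive {x} {a * b - + 1} 0≤x
    (i≤j⇒0≤j-i (≤-trans (≤-trans (+≤+ (s≤s z≤n)) (*-monoˡ-≤-nonNeg (+ 3) b≥1))
      (*-monoʳ-≤-nonNeg b {{nonNegative 0≤b}} a≥3)))
    (i+k≡j⇒i<j 0<e (trans (lower a b) (sym x²≡D-4)))
    -- The distance from `D - 4` up to `(ab)²` is `2b + 4`.
    (i+k≡j⇒i<j {k = + 2 * b + + 4}
      (+-mono-≤-< {+ 0} {_} {+ 0} (*-nonNeg {+ 2} (+≤+ z≤n) 0≤b) (+<+ {0} {4} (s≤s z≤n)))
      (trans (cong (_+ (+ 2 * b + + 4)) x²≡D-4) (upper a b)))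
    where
    x²≡D-4 : x * x ≡ disc a b * + 1 - + 4
    x²≡D-4 = trans (i≡i+4-4 (x * x)) (cong (_- + 4) sol)
    lower : ∀ a b → (a * b - + 1) * (a * b - + 1) + (+ 2 * (a - + 1) * b - + 5) ≡
      (a * (a * + 1) * (b * (b * + 1)) - + 2 * b) * + 1 - + 4
    lower = solve-∀
    upper : ∀ a b → (a * (a * + 1) * (b * (b * + 1)) - + 2 * b) * + 1 - + 4 + (+ 2 * b + + 4) ≡
      (+ 1 + (a * b - + 1)) * (+ 1 + (a * b - + 1))
    upper = solve-∀

  -- Well-founded induction on the second coordinate. The sign condition on `x` is part of the
  -- invariant because `descended-smaller` compares `a * x` with `(A - 1) y` through their squares.
  no-solution : ∀ {n} → Acc ℕ._<_ n → ∀ {x} → + 0 ≤ x → + 0 < + n →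
    ¬ NegFourSolution (disc a b) x (+ n)
  no-solution {0} _ _ (+<+ ()) _
  no-solution {1} _ 0≤x _ sol = no-solution-at-1 0≤x sol
  no-solution {n@(suc (suc _))} (acc rec) {x} 0≤x 0<n sol = descend {A * x - a * D * + n}
    (descended-pos D A a unit {x} 0≤unit 0<n sol)
    (descended-smaller D A a unit {x} 0≤a 0≤x (0<gap (+≤+ (s≤s (s≤s z≤n)))) sol)
    (unit-action D A a unit {x} sol)
    where
    D A : ℤ
    D = disc a b
    A = a * a * b - + 1
    unit : A * A ≡ + 1 + D * (a * a)
    unit = disc-unit a b
    descend : ∀ {x′ y′} → + 0 < y′ → y′ < + n → NegFourSolution D x′ y′ → ⊥
    -- The sign of `A * x - a * D * y` is not controlled. Passing to `∣ x′ ∣` restores `0 ≤ x` and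
    -- leaves the equation intact, since only the square occurs.
    descend {x′} {+ m} 0<m (+<+ m<n) sol′ = no-solution (rec m<n) {+ ∣ x′ ∣} (+≤+ z≤n) 0<m
      (trans (cong (_+ + 4) (+∣i∣²≡i² x′)) sol′)

theorem14 : ∀ (a b : ℤ) → a ≥ + 3 → b ≥ + 1 →
    ¬ (∃[ x ] ∃[ y ] (x > + 0 × y > + 0 ×
    x ^ 2 - (a ^ 2 * b ^ 2 - + 2 * b) * y ^ 2 ≡ - (+ 4)))
theorem14 a b a≥3 b≥1 (x , + n , x>0 , y>0 , eq) =
  no-solution a≥3 b≥1 (<-wellFounded n) (<⇒≤ x>0) y>0
    (i-j≡0⇒i≡j _ _ (trans (unfold-squares (disc a b) x (+ n)) (cong (_+ + 4) eq)))
  where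
  unfold-squares : ∀ D x y → x * x + + 4 - D * (y * y) ≡ x * (x * + 1) - D * (y * (y * + 1)) + + 4
  unfold-squares = solve-∀
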